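{- Consider deterministic automata $G$ over finite event sets $E$ with uncontrollable events $E_{uc}\subseteq E$, metrics $d$ on $E$ with values in $[0,1]$, and $\lambda\in[0,1]$. For languages $K,K_1,K_2\subseteq L(G)$: (1) If $K$ is prefix closed, then so is $K^{\Uparrow}$. (2) If $K_1\subseteq K_2$, then $K_1^{\Uparrow}\subseteq K_2^{\Uparrow}$. (3) $(K_1\cap K_2)^{\Uparrow}\subseteq K_1^{\Uparrow}\cap K_2^{\Uparrow}$; this inclusion can be strict (i.e. it is strict for some choice of $G,E_{uc},d,\lambda,K_1,K_2$). (4) $K_1^{\Uparrow}\cup K_2^{\Uparrow}\subseteq(K_1\cup K_2)^{\Uparrow}$; this inclusion can be strict (i.e. it is strict for some choice of $G,E_{uc},d,\lambda,K_1,K_2$).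
   Context: Setting. $E$ is a finite set of events, partitioned as $E=E_c\sqcup E_{uc}$ (controllable / uncontrollable events); $E^*$ is the set of finite strings over $E$ including the empty string $\epsilon$; $l(s)$ is the length of a string $s$; $\overline{L}$ is the prefix closure of a language $L\subseteq E^*$. $G=(Q,E,\delta,q_0)$ is a deterministic automaton with partial transition function $\delta:Q\times E\to Q$, extended to strings as usual, and $L(G)=\{s\in E^*:\delta(q_0,s)\text{ is defined}\}$ (a prefix closed language containing $\epsilon$). Metrics. $d$ is a metric on $E$ with values in $[0,1]$. Set $d(\epsilon,\epsilon)=0$ and $d(a,\epsilon)=d(\epsilon,a)=1$ for $a\in E$. For strings $s=s_1\cdots s_{l(s)}$, $t=t_1\cdots t_{l(t)}$, pad the shorter one with $\epsilon$'s and define $d(s,t)=\sum_{i=1}^{\max\{l(s),l(t)\}}2^{ -i}d(s_i,t_i)$. For a string $s$ and a language $A$, $d(s,A)=\inf_{a\in A}d(s,a)$ if $A\neq\emptyset$ and $d(s,\emptyset)=1$. For languages $A,B$, $d(A,B)$ is the Hausdorff metric: $d(\emptyset,\emptyset)=0$, and otherwise $d(A,B)=\max\{\sup_{a\in A}d(a,B),\sup_{b\in B}d(b,A)\}$ (a supremum over the empty set being $0$). Controllability. A language $K\subseteq L(G)$ is controllable if $\overline{K}E_{uc}\cap L(G)\subseteq\overline{K}$. A language $K\subseteq L(G)$ is $\lambda$-controllable if there is a controllable language $\widetilde K\subseteq L(G)$ with $d(\widetilde K,K)\le\lambda$. For $K\subseteq L(G)$, $K^{\Uparrow}$ denotes the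 supremal $\lambda$-controllable sublanguage of $K$, i.e. the union of all $\lambda$-controllable languages $M\subseteq K$ (it is itself $\lambda$-controllable). -}

module Defs where

open import Data.Fin.Base using (Fin; toℕ)
open import Data.List.Base using (List; []; _∷_; _++_; _∷ʳ_; length; head; drop)
open import Data.Maybe using (Is-just)
open import Data.Maybe.Base using (Maybe; just; nothing; _>>=_)
open import Data.Nat.Base as ℕ using (ℕ; zero; suc; _⊔_)
open import Data.Product.Base using (∃; ∃-syntax; _×_; _,_)
open import Data.Rational.Base as ℚ using (ℚ; 0ℚ; 1ℚ; ½; ∣_∣)
open import Data.Rational.Solver using (module +-*-Solver)
import Data.Rational.Properties as ℚ
open import Data.Vec.Functional using (foldr)
open import Function.Base using (_∘_)
open import Function.Bundles using (_↔_)
open import Function.Metric.Structures using (IsGeneralMetric)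
open import Level using (Level; 0ℓ) renaming (suc to lsuc)
open import Relation.Binary.Core using (Rel)
open import Relation.Binary.PropositionalEquality using (_≡_; refl; sym; cong; subst)
open import Relation.Unary using (Pred; _∈_; _⊆_; _≐_; _∩_; _∪_; Empty; Universal)

------------------------------------------------------------------------
-- Real numbers, as Cauchy sequences of rationals with fixed modulus 2⁻ⁿ

½^_ : ℕ → ℚ
½^ zero  = 1ℚ
½^ suc n = ½ ℚ.* ½^ n

record ℝ : Set where
  field
    approx  : ℕ → ℚ
    regular : ∀ m n → ∣ approx m ℚ.- approx n ∣ ℚ.≤ ½^ m ℚ.+ ½^ n

open ℝ public

infix 4 _≤_ _≈_

_≤_ : Rel ℝ 0ℓ
x ≤ y = ∀ n → approx x n ℚ.≤ approx y n ℚ.+ (½^ n ℚ.+ ½^ n)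

_≈_ : Rel ℝ 0ℓ
x ≈ y = x ≤ y × y ≤ x

½^-nonNeg : ∀ n → 0ℚ ℚ.≤ ½^ n
½^-nonNeg zero    = ℚ.<⇒≤ (ℚ.positive⁻¹ 1ℚ)
½^-nonNeg (suc n) = subst (ℚ._≤ ½ ℚ.* ½^ n) (ℚ.*-zeroʳ ½)
                      (ℚ.*-monoˡ-≤-nonNeg ½ (½^-nonNeg n))

fromℚ : ℚ → ℝ
fromℚ q .approx  _   = q
fromℚ q .regular m n = begin
  ∣ q ℚ.- q ∣     ≡⟨ cong ∣_∣ (ℚ.+-inverseʳ q) ⟩
  0ℚ              ≤⟨ ℚ.+-mono-≤ (½^-nonNeg m) (½^-nonNeg n) ⟩
  ½^ m ℚ.+ ½^ n   ∎
  where open ℚ.≤-Reasoning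

0ℝ 1ℝ : ℝ
0ℝ = fromℚ 0ℚ
1ℝ = fromℚ 1ℚ

infixl 6 _+_

_+_ : ℝ → ℝ → ℝ
(x + y) .approx  n   = approx x (suc n) ℚ.+ approx y (suc n)
(x + y) .regular m n = begin
  ∣ (x′ m ℚ.+ y′ m) ℚ.- (x′ n ℚ.+ y′ n) ∣
    ≡⟨ cong ∣_∣ (solve 4 (λ a b c d → (a :+ b) :- (c :+ d) := (a :- c) :+ (b :- d))
                   refl (x′ m) (y′ m) (x′ n) (y′ n)) ⟩
  ∣ (x′ m ℚ.- x′ n) ℚ.+ (y′ m ℚ.- y′ n) ∣
    ≤⟨ ℚ.∣p+q∣≤∣p∣+∣q∣ (x′ m ℚ.- x′ n) (y′ m ℚ.- y′ n) ⟩
  ∣ x′ m ℚ.- x′ n ∣ ℚ.+ ∣ y′ m ℚ.- y′ n ∣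
    ≤⟨ ℚ.+-mono-≤ (regular x (suc m) (suc n)) (regular y (suc m) (suc n)) ⟩
  (½^ suc m ℚ.+ ½^ suc n) ℚ.+ (½^ suc m ℚ.+ ½^ suc n)
    ≡⟨ solve 2 (λ a b → (con ½ :* a :+ con ½ :* b) :+ (con ½ :* a :+ con ½ :* b) := a :+ b)
         refl (½^ m) (½^ n) ⟩
  ½^ m ℚ.+ ½^ n ∎
  where
  open ℚ.≤-Reasoning
  open +-*-Solver
  x′ y′ : ℕ → ℚ
  x′ = approx x ∘ suc
  y′ = approx y ∘ suc

half : ℝ → ℝ
half x .approx  n   = ½ ℚ.* approx x n
half x .regular m n = begin
  ∣ ½ ℚ.* approx x m ℚ.- ½ ℚ.* approx x n ∣
    ≡⟨ cong ∣_∣ (solve 2 (λ a b → con ½ :* a :- con ½ :* b := con ½ :* (a :- b))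
                   refl (approx x m) (approx x n)) ⟩
  ∣ ½ ℚ.* Δ ∣              ≡⟨ ℚ.∣p*q∣≡∣p∣*∣q∣ ½ Δ ⟩
  ½ ℚ.* ∣ Δ ∣              ≤⟨ ℚ.*-monoʳ-≤-nonNeg ∣ Δ ∣ {{ℚ.nonNegative (ℚ.0≤∣p∣ Δ)}} ½≤1 ⟩
  1ℚ ℚ.* ∣ Δ ∣             ≡⟨ ℚ.*-identityˡ ∣ Δ ∣ ⟩
  ∣ Δ ∣                    ≤⟨ regular x m n ⟩
  ½^ m ℚ.+ ½^ n            ∎
  where
  open ℚ.≤-Reasoning
  open +-*-Solver
  Δ = approx x m ℚ.- approx x n
  ½≤1 : ½ ℚ.≤ 1ℚ
  ½≤1 = ℚ.≤ᵇ⇒≤ _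

infixr 8 2⁻_·_

2⁻_·_ : ℕ → ℝ → ℝ
2⁻ zero  · x = x
2⁻ suc k · x = half (2⁻ k · x)

∑< : ∀ n → (ℕ → ℝ) → ℝ
∑< n f = foldr _+_ 0ℝ (λ (i : Fin n) → f (toℕ i))

------------------------------------------------------------------------
-- Infima and suprema over arbitrary languages need not exist constructively
-- as elements of ℝ. They do as upper reals, a number being given by the set
-- of all rationals strictly greater than it.

ℝᵘ : Set₁
ℝᵘ = Pred ℚ 0ℓ

upper : ℝ → ℝᵘ
upper x q = ∃[ n ] approx x n ℚ.+ ½^ n ℚ.< q

infix 4 _≤ᵘ_

_≤ᵘ_ : Rel ℝᵘ 0ℓ
x ≤ᵘ y = y ⊆ x

maxᵘ : ℝᵘ → ℝᵘ → ℝᵘ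
maxᵘ x y = x ∩ y

module _ {X : Set} where

  infᵘ : Pred X 0ℓ → (X → ℝᵘ) → ℝᵘ
  infᵘ A f q = ∃[ a ] a ∈ A × q ∈ f a

  -- The supremum among nonnegative numbers; in particular it is 0 over the
  -- empty set. The intermediate r makes the inequality sup < q strict.
  supᵘ : Pred X 0ℓ → (X → ℝᵘ) → ℝᵘ
  supᵘ A f q = ∃[ r ] 0ℚ ℚ.≤ r × r ℚ.< q × (∀ a → a ∈ A → r ∈ f a)

------------------------------------------------------------------------
-- Languages

module _ {E : Set} where

  closure : ∀ {ℓ} → Pred (List E) ℓ → Pred (List E) ℓ
  closure L s = ∃[ t ] s ++ t ∈ L

  PrefixClosed : ∀ {ℓ} → Pred (List E) ℓ → Set ℓ
  PrefixClosed L = L ≐ closure L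

  infixl 7 _·ᴸ_

  _·ᴸ_ : Pred (List E) 0ℓ → Pred E 0ℓ → Pred (List E) 0ℓ
  (L ·ᴸ A) w = ∃[ s ] ∃[ a ] w ≡ s ∷ʳ a × s ∈ L × a ∈ A

------------------------------------------------------------------------
-- Automata

record Automaton (E : Set) : Set₁ where
  field
    Q  : Set
    δ  : Q → E → Maybe Q
    q₀ : Q

  δ* : Q → List E → Maybe Q
  δ* q []      = just q
  δ* q (a ∷ s) = δ q a >>= λ q′ → δ* q′ s

  generated : Pred (List E) 0ℓ
  generated s = Is-just (δ* q₀ s)

------------------------------------------------------------------------
-- Distances between strings and between languages

module Distance {E : Set} (d : E → E → ℝ) where

  -- nothing is the padding symbol ε.
  dε : Maybe E → Maybe E → ℝ
  dε nothing  nothing  = 0ℝ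
  dε (just _) nothing  = 1ℝ
  dε nothing  (just _) = 1ℝ
  dε (just a) (just b) = d a b

  -- Indices start at 0 here, so the i-th term has weight 2⁻⁽ⁱ⁺¹⁾.
  dString : List E → List E → ℝ
  dString s t = ∑< (length s ⊔ length t) λ i →
    2⁻ suc i · dε (head (drop i s)) (head (drop i t))

  -- inf over A if A is nonempty, and 1 if A is empty.
  dPoint : List E → Pred (List E) 0ℓ → ℝᵘ
  dPoint s A = infᵘ A (λ a → upper (dString s a))
             ∪ (λ q → Empty A × q ∈ upper 1ℝ)

  -- For A and B both empty this is 0, by the convention on supᵘ.
  dHausdorff : Pred (List E) 0ℓ → Pred (List E) 0ℓ → ℝᵘ
  dHausdorff A B = maxᵘ (supᵘ A (λ a → dPoint a B)) (supᵘ B (λ b → dPoint b A))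

------------------------------------------------------------------------
-- λ-controllability

record Setting : Set₁ where
  field
    E         : Set
    E-finite  : ∃[ n ] E ↔ Fin n
    Ec Euc    : Pred E 0ℓ
    covering  : Universal (Ec ∪ Euc)
    disjoint  : Empty (Ec ∩ Euc)
    G         : Automaton E
    d         : E → E → ℝ
    d-metric  : IsGeneralMetric _≡_ _≈_ _≤_ 0ℝ _+_ d
    d≤1       : ∀ a b → d a b ≤ 1ℝ
    tolerance : ℝ
    0≤tolerance : 0ℝ ≤ tolerance
    tolerance≤1 : tolerance ≤ 1ℝ

  Language : Set₁
  Language = Pred (List E) 0ℓ

  L[G] : Language
  L[G] = Automaton.generated G

  open Distance d public

  Controllable : Language → Set
  Controllable K = K ⊆ L[G] × (closure K ·ᴸ Euc) ∩ L[G] ⊆ closure K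

  λ-Controllable : Language → Set₁
  λ-Controllable K =
    K ⊆ L[G] × ∃[ K̃ ] Controllable K̃ × dHausdorff K̃ K ≤ᵘ upper tolerance

  infix 10 _⇑

  -- The union of all λ-controllable sublanguages; quantifying over languages
  -- raises the universe level by one.
  _⇑ : Language → Pred (List E) (lsuc 0ℓ)
  (K ⇑) s = ∃[ M ] M ⊆ K × λ-Controllable M × s ∈ M

{-# OPTIONS --safe #-}

-- Truncating two strings at the same length does not increase their distance, so
-- the Hausdorff distance does not increase when both languages are replaced by
-- their prefix closures; hence the closure of a λ-controllable language is
-- λ-controllable, which gives (1). The inclusions in (2)–(4) are monotonicity.
--
-- Both strictness examples live over a single uncontrollable event u with
-- L(G) = u* and λ = 0. Every nonempty controllable language then contains
-- nonempty strings, which are at distance at least ½ from ε, so {ε} is not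
-- λ-controllable, whereas every infinite language is controllable. For (3) take
-- the strings of even length and ε together with the strings of odd length; for
-- (4) take {ε} and its complement.
module Submission where

open import Defs
open import Data.Fin.Properties using (1↔⊤)
import Data.Integer.Base as ℤ
open import Data.List.Base using (List; []; _∷_; _++_; length; head; take; drop)
import Data.List.Properties as List
open import Data.Maybe using (Is-just)
open import Data.Maybe.Base using (just; nothing)
import Data.Maybe.Relation.Unary.Any as Maybe
open import Data.Nat.Base as ℕ using (ℕ; zero; suc; z≤n; s≤s; _⊔_)
import Data.Nat.Properties as ℕ
open import Data.Product.Base using (_×_; ∃-syntax; _,_; proj₁; proj₂; map₂)
open import Data.Rational.Base as ℚ using (ℚ; mkℚ; 0ℚ; 1ℚ; ½; ∣_∣; toℚᵘ)
import Data.Rational.Properties as ℚ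
open import Data.Rational.Solver using (module +-*-Solver)
open import Data.Rational.Unnormalised.Base as ℚᵘ using (mkℚᵘ)
import Data.Rational.Unnormalised.Properties as ℚᵘ
open import Data.Sum.Base using (inj₁; inj₂; [_,_])
open import Data.Unit.Base using (⊤; tt)
open import Function.Base using (_∘_; id)
open import Function.Metric.Structures using (IsGeneralMetric)
open import Function.Properties.Inverse using (↔-sym)
open import Relation.Binary.PropositionalEquality
  using (_≡_; refl; sym; trans; cong; subst; isEquivalence)
open import Relation.Binary.Structures using (IsPartialOrder)
open import Relation.Nullary.Negation using (¬_; contradiction)
open import Relation.Unary using (Pred; ∅; U; ∁; ｛_｝; _∈_; _⊆_; _⊂_; _∩_; _∪_)

-- Rationals

-- Induction: half of 1/(n+1) is 1/(2n+2), which is at most 1/(n+2). Unnormalised rationals spare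
-- coprimality proofs.
½^≤1/1+n : ∀ n → toℚᵘ (½^ n) ℚᵘ.≤ mkℚᵘ (ℤ.+ 1) n
½^≤1/1+n zero    = ℚᵘ.≤-refl
½^≤1/1+n (suc n) = begin
  toℚᵘ (½ ℚ.* ½^ n)                ≃⟨ ℚ.toℚᵘ-homo-* ½ (½^ n) ⟩
  toℚᵘ ½ ℚᵘ.* toℚᵘ (½^ n)          ≤⟨ ℚᵘ.*-monoʳ-≤-nonNeg (toℚᵘ ½) (½^≤1/1+n n) ⟩
  toℚᵘ ½ ℚᵘ.* mkℚᵘ (ℤ.+ 1) n       ≤⟨ ℚᵘ.*≤* (ℤ.+≤+ lemma) ⟩
  mkℚᵘ (ℤ.+ 1) (suc n)             ∎
  where
  open ℚᵘ.≤-Reasoning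
  lemma : 1 ℕ.* suc (suc n) ℕ.≤ 1 ℕ.* (2 ℕ.* suc n)
  lemma = ℕ.*-monoʳ-≤ 1 (s≤s (subst (suc n ℕ.≤_) (sym (ℕ.+-suc n _))
            (s≤s (ℕ.m≤m+n n _))))

½^-archimedean : ∀ {p} → 0ℚ ℚ.< p → ∃[ n ] ½^ n ℚ.< p
-- Here p = (k+1)/(d+1), which exceeds 1/(d+2).
½^-archimedean {p@(mkℚ ℤ.+[1+ k ] d _)} _ = suc d , ℚ.toℚᵘ-cancel-< (begin-strict
  toℚᵘ (½^ suc d)         ≤⟨ ½^≤1/1+n (suc d) ⟩
  mkℚᵘ (ℤ.+ 1) (suc d)    <⟨ ℚᵘ.*<* (ℤ.+<+ lemma) ⟩
  toℚᵘ p                  ∎)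
  where
  open ℚᵘ.≤-Reasoning
  lemma : 1 ℕ.* suc d ℕ.< suc k ℕ.* suc (suc d)
  lemma = ℕ.*-mono-≤ {1} {suc k} (s≤s z≤n) (ℕ.n<1+n (suc d))
½^-archimedean {mkℚ ℤ.+0 _ _} (ℚ.*<* (ℤ.+<+ ()))
½^-archimedean {mkℚ ℤ.-[1+ _ ] _ _} (ℚ.*<* ())

p<q⇒0<q-p : ∀ {p q} → p ℚ.< q → 0ℚ ℚ.< q ℚ.- p
p<q⇒0<q-p {p} {q} p<q =
  subst (ℚ._< q ℚ.- p) (ℚ.+-inverseʳ p) (ℚ.+-monoˡ-< (ℚ.- p) p<q)

p+[q-p]≡q : ∀ p q → p ℚ.+ (q ℚ.- p) ≡ q
p+[q-p]≡q = solve 2 (λ p q → p :+ (q :- p) := q) refl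
  where open +-*-Solver

≤+½^⇒≤ : ∀ {p q} → (∀ k → p ℚ.≤ q ℚ.+ ½^ k) → p ℚ.≤ q
≤+½^⇒≤ {p} {q} p≤q+½^ = ℚ.≮⇒≥ λ q<p →
  let k , ½^k<p-q = ½^-archimedean (p<q⇒0<q-p q<p) in
  ℚ.<-irrefl refl (ℚ.≤-<-trans (p≤q+½^ k)
    (subst (q ℚ.+ ½^ k ℚ.<_) (p+[q-p]≡q q p) (ℚ.+-monoʳ-< q ½^k<p-q)))

p≤∣p∣ : ∀ p → p ℚ.≤ ∣ p ∣
p≤∣p∣ p with ℚ.≤-total 0ℚ p
... | inj₁ 0≤p = ℚ.≤-reflexive (sym (ℚ.0≤p⇒∣p∣≡p 0≤p))
... | inj₂ p≤0 = ℚ.≤-trans p≤0 (ℚ.0≤∣p∣ p)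

p≤p+½^ : ∀ p n → p ℚ.≤ p ℚ.+ ½^ n
p≤p+½^ p n = subst (ℚ._≤ p ℚ.+ ½^ n) (ℚ.+-identityʳ p) (ℚ.+-monoʳ-≤ p (½^-nonNeg n))

-- Reals

approx-shift : ∀ x m n → approx x m ℚ.≤ approx x n ℚ.+ (½^ m ℚ.+ ½^ n)
approx-shift x m n = begin
  xₘ                          ≡⟨ p+[q-p]≡q xₙ xₘ ⟨
  xₙ ℚ.+ (xₘ ℚ.- xₙ)          ≤⟨ ℚ.+-monoʳ-≤ xₙ (p≤∣p∣ (xₘ ℚ.- xₙ)) ⟩
  xₙ ℚ.+ ∣ xₘ ℚ.- xₙ ∣        ≤⟨ ℚ.+-monoʳ-≤ xₙ (regular x m n) ⟩
  xₙ ℚ.+ (½^ m ℚ.+ ½^ n)      ∎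
  where
  open ℚ.≤-Reasoning
  xₘ = approx x m
  xₙ = approx x n

≤-refl : ∀ x → x ≤ x
≤-refl x n = ℚ.≤-trans (p≤p+½^ _ n) (ℚ.≤-trans (p≤p+½^ _ n)
               (ℚ.≤-reflexive (ℚ.+-assoc (approx x n) (½^ n) (½^ n))))

≤-trans : ∀ x y z → x ≤ y → y ≤ z → x ≤ z
≤-trans x y z x≤y y≤z n = ≤+½^⇒≤ λ k →
  -- Comparing at index n directly would cost 4h, but only 2h is allowed. The detour through the
  -- finer index m costs 2h + 6e; two more copies of e are added because 8e = `½^ k`, a slack that
  -- `≤+½^⇒≤` removes.
  let m = 3 ℕ.+ k
      e = ½^ m
      h = ½^ n
  in begin
  approx x n
    ≤⟨ approx-shift x n m ⟩
  approx x m ℚ.+ (h ℚ.+ e)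
    ≤⟨ ℚ.+-monoˡ-≤ (h ℚ.+ e) (x≤y m) ⟩
  approx y m ℚ.+ (e ℚ.+ e) ℚ.+ (h ℚ.+ e)
    ≤⟨ ℚ.+-monoˡ-≤ (h ℚ.+ e) (ℚ.+-monoˡ-≤ (e ℚ.+ e) (y≤z m)) ⟩
  approx z m ℚ.+ (e ℚ.+ e) ℚ.+ (e ℚ.+ e) ℚ.+ (h ℚ.+ e)
    ≤⟨ ℚ.+-monoˡ-≤ (h ℚ.+ e) (ℚ.+-monoˡ-≤ (e ℚ.+ e) (ℚ.+-monoˡ-≤ (e ℚ.+ e)
         (approx-shift z m n))) ⟩
  approx z n ℚ.+ (e ℚ.+ h) ℚ.+ (e ℚ.+ e) ℚ.+ (e ℚ.+ e) ℚ.+ (h ℚ.+ e)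
    ≤⟨ ℚ.≤-trans (p≤p+½^ _ m) (p≤p+½^ _ m) ⟩
  approx z n ℚ.+ (e ℚ.+ h) ℚ.+ (e ℚ.+ e) ℚ.+ (e ℚ.+ e) ℚ.+ (h ℚ.+ e) ℚ.+ e ℚ.+ e
    ≡⟨ solve 3 (λ c h k → let e = con ½ :* (con ½ :* (con ½ :* k)) in
                  c :+ (e :+ h) :+ (e :+ e) :+ (e :+ e) :+ (h :+ e) :+ e :+ e
                    := c :+ (h :+ h) :+ k)
         refl (approx z n) h (½^ k) ⟩
  approx z n ℚ.+ (h ℚ.+ h) ℚ.+ ½^ k ∎
  where
  open ℚ.≤-Reasoning
  open +-*-Solver

≤-isPartialOrder : IsPartialOrder _≈_ _≤_
≤-isPartialOrder = record
  { isPreorder = record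
    { isEquivalence = record
      { refl  = λ {x} → ≤-refl x , ≤-refl x
      ; sym   = λ (x≤y , y≤x) → y≤x , x≤y
      ; trans = λ {x} {y} {z} (x≤y , y≤x) (y≤z , z≤y) →
                  ≤-trans x y z x≤y y≤z , ≤-trans z y x z≤y y≤x
      }
    ; reflexive = proj₁
    ; trans     = λ {x} {y} {z} → ≤-trans x y z
    }
  ; antisym = _,_
  }

+-mono-≤ : ∀ x y x′ y′ → x ≤ x′ → y ≤ y′ → x + y ≤ x′ + y′
+-mono-≤ x y x′ y′ x≤x′ y≤y′ n = begin
  approx x (suc n) ℚ.+ approx y (suc n)
    ≤⟨ ℚ.+-mono-≤ (x≤x′ (suc n)) (y≤y′ (suc n)) ⟩
  (a ℚ.+ (e ℚ.+ e)) ℚ.+ (b ℚ.+ (e ℚ.+ e))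
    ≡⟨ solve 3 (λ a b h → let e = con ½ :* h in
                  (a :+ (e :+ e)) :+ (b :+ (e :+ e)) := (a :+ b) :+ (h :+ h))
         refl a b (½^ n) ⟩
  (a ℚ.+ b) ℚ.+ (½^ n ℚ.+ ½^ n) ∎
  where
  open ℚ.≤-Reasoning
  open +-*-Solver
  a = approx x′ (suc n)
  b = approx y′ (suc n)
  e = ½^ suc n

half-mono-≤ : ∀ x y → x ≤ y → half x ≤ half y
half-mono-≤ x y x≤y n = begin
  ½ ℚ.* approx x n
    ≤⟨ ℚ.*-monoˡ-≤-nonNeg ½ (x≤y n) ⟩
  ½ ℚ.* (approx y n ℚ.+ (½^ n ℚ.+ ½^ n))
    ≡⟨ solve 2 (λ a e → con ½ :* (a :+ (e :+ e)) := con ½ :* a :+ e)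
         refl (approx y n) (½^ n) ⟩
  ½ ℚ.* approx y n ℚ.+ ½^ n
    ≤⟨ p≤p+½^ _ n ⟩
  ½ ℚ.* approx y n ℚ.+ ½^ n ℚ.+ ½^ n
    ≡⟨ ℚ.+-assoc (½ ℚ.* approx y n) (½^ n) (½^ n) ⟩
  ½ ℚ.* approx y n ℚ.+ (½^ n ℚ.+ ½^ n) ∎
  where
  open ℚ.≤-Reasoning
  open +-*-Solver

2⁻-nonNeg : ∀ k x → 0ℝ ≤ x → 0ℝ ≤ 2⁻ k · x
2⁻-nonNeg zero    x 0≤x = 0≤x
2⁻-nonNeg (suc k) x 0≤x = half-mono-≤ 0ℝ (2⁻ k · x) (2⁻-nonNeg k x 0≤x)

2⁻-nonPos : ∀ k x → x ≤ 0ℝ → 2⁻ k · x ≤ 0ℝ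
2⁻-nonPos zero    x x≤0 = x≤0
2⁻-nonPos (suc k) x x≤0 = half-mono-≤ (2⁻ k · x) 0ℝ (2⁻-nonPos k x x≤0)

∑<-nonNeg : ∀ n f → (∀ i → 0ℝ ≤ f i) → 0ℝ ≤ ∑< n f
∑<-nonNeg zero    f 0≤f = ≤-refl 0ℝ
∑<-nonNeg (suc n) f 0≤f =
  +-mono-≤ 0ℝ 0ℝ (f 0) (∑< n (f ∘ suc)) (0≤f 0) (∑<-nonNeg n (f ∘ suc) (0≤f ∘ suc))

∑<-nonPos : ∀ n f → (∀ i → f i ≤ 0ℝ) → ∑< n f ≤ 0ℝ
∑<-nonPos zero    f f≤0 = ≤-refl 0ℝ
∑<-nonPos (suc n) f f≤0 =
  +-mono-≤ (f 0) (∑< n (f ∘ suc)) 0ℝ 0ℝ (f≤0 0) (∑<-nonPos n (f ∘ suc) (f≤0 ∘ suc))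

-- The summands of `g` beyond `m` only add. Comparing terms below `m` alone suits truncated strings,
-- whose terms agree with the original ones only there.
∑<-mono-≤ : ∀ {m n} f g → m ℕ.≤ n → (∀ i → i ℕ.< m → f i ≤ g i) →
            (∀ i → 0ℝ ≤ g i) → ∑< m f ≤ ∑< n g
∑<-mono-≤ {n = n} f g z≤n f≤g 0≤g = ∑<-nonNeg n g 0≤g
∑<-mono-≤ {suc m} {suc n} f g (s≤s m≤n) f≤g 0≤g =
  +-mono-≤ (f 0) (∑< m (f ∘ suc)) (g 0) (∑< n (g ∘ suc)) (f≤g 0 (s≤s z≤n))
    (∑<-mono-≤ (f ∘ suc) (g ∘ suc) m≤n (λ i i<m → f≤g (suc i) (s≤s i<m)) (0≤g ∘ suc))

upper-mono-≤ : ∀ x y → x ≤ y → upper x ≤ᵘ upper y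
upper-mono-≤ x y x≤y {q} (n , yₙ+½^n<q) =
  let b       = approx y n ℚ.+ ½^ n
      k , ½^k<q-b = ½^-archimedean (p<q⇒0<q-p yₙ+½^n<q)
      -- Passing from `y` at n to `x` at m costs 4e in total, and 4e = `½^ k` fits into the gap q -
      -- b.
      m       = 2 ℕ.+ k
      e       = ½^ m
  in m , (begin-strict
  approx x m ℚ.+ e
    ≤⟨ ℚ.+-monoˡ-≤ e (x≤y m) ⟩
  approx y m ℚ.+ (e ℚ.+ e) ℚ.+ e
    ≤⟨ ℚ.+-monoˡ-≤ e (ℚ.+-monoˡ-≤ (e ℚ.+ e) (approx-shift y m n)) ⟩
  approx y n ℚ.+ (e ℚ.+ ½^ n) ℚ.+ (e ℚ.+ e) ℚ.+ e
    ≡⟨ solve 3 (λ a h k → let e = con ½ :* (con ½ :* k) in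
                  a :+ (e :+ h) :+ (e :+ e) :+ e := (a :+ h) :+ k)
         refl (approx y n) (½^ n) (½^ k) ⟩
  b ℚ.+ ½^ k
    <⟨ ℚ.+-monoʳ-< b ½^k<q-b ⟩
  b ℚ.+ (q ℚ.- b)
    ≡⟨ p+[q-p]≡q b q ⟩
  q ∎)
  where
  open ℚ.≤-Reasoning
  open +-*-Solver

upper-fromℚ⁺ : ∀ {p q} → p ℚ.< q → q ∈ upper (fromℚ p)
upper-fromℚ⁺ {p} {q} p<q =
  let n , ½^n<q-p = ½^-archimedean (p<q⇒0<q-p p<q) in
  n , subst (p ℚ.+ ½^ n ℚ.<_) (p+[q-p]≡q p q) (ℚ.+-monoʳ-< p ½^n<q-p)

upper-fromℚ⁻ : ∀ {p q} → q ∈ upper (fromℚ p) → p ℚ.< q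
upper-fromℚ⁻ {p} (n , p+½^n<q) = ℚ.≤-<-trans (p≤p+½^ p n) p+½^n<q

-- Prefix closures

module _ {E : Set} where

  head-drop-take : ∀ {i k} (s : List E) → i ℕ.< k →
                   head (drop i (take k s)) ≡ head (drop i s)
  head-drop-take {i}     {suc k} []      i<k       = refl
  head-drop-take {zero}  {suc k} (a ∷ s) i<k       = refl
  head-drop-take {suc i} {suc k} (a ∷ s) (s≤s i<k) = head-drop-take s i<k

  ⊆-closure : ∀ {ℓ} (L : Pred (List E) ℓ) → L ⊆ closure L
  ⊆-closure L {s} s∈L = [] , subst L (sym (List.++-identityʳ s)) s∈L

  closure-idem : ∀ {ℓ} (L : Pred (List E) ℓ) → closure (closure L) ⊆ closure L
  closure-idem L {s} (t , u , stu∈L) = t ++ u , subst L (List.++-assoc s t u) stu∈L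

module _ {E : Set} (A : Automaton E) where
  open Automaton A

  δ*-prefix : ∀ q s t → Is-just (δ* q (s ++ t)) → Is-just (δ* q s)
  δ*-prefix q []      t _ = Maybe.just tt
  δ*-prefix q (a ∷ s) t def with δ q a
  ... | just q′ = δ*-prefix q′ s t def

-- Distances and λ-controllability under prefix closure

module _ (S : Setting) where
  open Setting S

  private module d = IsGeneralMetric d-metric

  dε-nonNeg : ∀ a b → 0ℝ ≤ dε a b
  dε-nonNeg nothing  nothing  = ≤-refl 0ℝ
  dε-nonNeg nothing  (just _) n = ℚ.≤-trans (ℚ.≤ᵇ⇒≤ _) (≤-refl 1ℝ n)
  dε-nonNeg (just _) nothing  n = ℚ.≤-trans (ℚ.≤ᵇ⇒≤ _) (≤-refl 1ℝ n)
  dε-nonNeg (just a) (just b) = d.nonNegative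

  dε-self : ∀ a → dε a a ≤ 0ℝ
  dε-self nothing  = ≤-refl 0ℝ
  dε-self (just a) = proj₁ (d.≈⇒0 refl)

  term : List E → List E → ℕ → ℝ
  term s t i = 2⁻ suc i · dε (head (drop i s)) (head (drop i t))

  term-nonNeg : ∀ s t i → 0ℝ ≤ term s t i
  term-nonNeg s t i = 2⁻-nonNeg (suc i) (dε (head (drop i s)) (head (drop i t)))
                        (dε-nonNeg (head (drop i s)) (head (drop i t)))

  dString-self : ∀ s → dString s s ≤ 0ℝ
  dString-self s = ∑<-nonPos (length s ⊔ length s) (term s s) λ i →
    2⁻-nonPos (suc i) (dε (head (drop i s)) (head (drop i s))) (dε-self (head (drop i s)))

  -- Terms at positions below the truncated lengths are unchanged; all further terms on the right
  -- are nonnegative.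
  dString-take-≤ : ∀ k s t → dString (take k s) (take k t) ≤ dString s t
  dString-take-≤ k s t =
    ∑<-mono-≤ (term (take k s) (take k t)) (term s t) (ℕ.⊔-mono-≤ (take≤ s) (take≤ t))
      term-≤ (term-nonNeg s t)
    where
    take≤ : (u : List E) → length (take k u) ℕ.≤ length u
    take≤ u = ℕ.≤-trans (ℕ.≤-reflexive (List.length-take k u)) (ℕ.m⊓n≤n k _)

    take≤k : (u : List E) → length (take k u) ℕ.≤ k
    take≤k u = ℕ.≤-trans (ℕ.≤-reflexive (List.length-take k u)) (ℕ.m⊓n≤m k _)

    term-≤ : ∀ i → i ℕ.< length (take k s) ⊔ length (take k t) →
             term (take k s) (take k t) i ≤ term s t i
    term-≤ i i<m
      rewrite head-drop-take s (ℕ.<-≤-trans i<m (ℕ.⊔-lub (take≤k s) (take≤k t)))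
            | head-drop-take t (ℕ.<-≤-trans i<m (ℕ.⊔-lub (take≤k s) (take≤k t)))
      = ≤-refl (term s t i)

  -- Truncating both `s ++ t` and a point `b` of `B` to the length of `s` turns the former into `s`
  -- and the latter into a point of `closure B`.
  dPoint-prefix : ∀ s t (B : Language) → dPoint s (closure B) ≤ᵘ dPoint (s ++ t) B
  dPoint-prefix s t B (inj₁ (b , b∈B , q∈)) = inj₁
    ( take k b
    , (drop k b , subst B (sym (List.take++drop≡id k b)) b∈B)
    , upper-mono-≤ (dString s (take k b)) (dString (s ++ t) b)
        (subst (λ u → dString u (take k b) ≤ dString (s ++ t) b)
          (take-length-++ s) (dString-take-≤ k (s ++ t) b)) q∈
    )
    where
    k = length s
    take-length-++ : ∀ s → take (length s) (s ++ t) ≡ s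
    take-length-++ []      = refl
    take-length-++ (a ∷ s) = cong (a ∷_) (take-length-++ s)
  -- The closure of an empty language is empty, so the default distance 1 applies on both sides.
  dPoint-prefix s t B (inj₂ (B-empty , 1<q)) =
    inj₂ ((λ u (v , uv∈B) → B-empty (u ++ v) uv∈B) , 1<q)

  dHausdorff-closure-≤ : ∀ (A B : Language) →
                         dHausdorff (closure A) (closure B) ≤ᵘ dHausdorff A B
  dHausdorff-closure-≤ A B (supA , supB) = sup-closure A B supA , sup-closure B A supB
    where
    sup-closure : ∀ (A B : Language) → supᵘ (closure A) (λ a → dPoint a (closure B))
                                       ≤ᵘ supᵘ A (λ a → dPoint a B)
    -- The same bound `r` works: a prefix inherits it from its extension in `A`.
    sup-closure A B (r , 0≤r , r<q , r∈) =
      r , 0≤r , r<q , λ s (t , st∈A) → dPoint-prefix s t B (r∈ (s ++ t) st∈A)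

  L[G]-closure : ∀ (K : Language) → K ⊆ L[G] → closure K ⊆ L[G]
  L[G]-closure K K⊆L {s} (t , st∈K) = δ*-prefix G (Automaton.q₀ G) s t (K⊆L st∈K)

  -- Apart from the inclusion in `L[G]`, controllability refers to `K` only through its closure, and
  -- closure is idempotent.
  closure-controllable : ∀ (K : Language) → Controllable K → Controllable (closure K)
  closure-controllable K (K⊆L , K-ctrl) = L[G]-closure K K⊆L ,
    λ ((s , a , w≡sa , s∈K̿ , a∈Euc) , w∈L) →
      ⊆-closure (closure K) (K-ctrl ((s , a , w≡sa , closure-idem K s∈K̿ , a∈Euc) , w∈L))

  closure-λ-controllable : ∀ (M : Language) → λ-Controllable M → λ-Controllable (closure M)
  closure-λ-controllable M (M⊆L , K̃ , K̃-ctrl , d≤λ) =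
    L[G]-closure M M⊆L , closure K̃ , closure-controllable K̃ K̃-ctrl ,
    λ q∈ → dHausdorff-closure-≤ K̃ M (d≤λ q∈)

  ⇑-prefixClosed : ∀ (K : Language) → PrefixClosed K → PrefixClosed (K ⇑)
  ⇑-prefixClosed K (_ , K̄⊆K) = ⊆-closure (K ⇑) ,
    λ (t , M , M⊆K , M-ctrl , st∈M) →
      -- `closure M` stays inside `K` because `K` is prefix closed, and it contains every prefix of
      -- a string of `M`.
      closure M , (λ (u , su∈M) → K̄⊆K (u , M⊆K su∈M)) ,
      closure-λ-controllable M M-ctrl , t , st∈M

  -- Monotonicity and its consequences for intersections and unions

  ⇑-mono : ∀ (K₁ K₂ : Language) → K₁ ⊆ K₂ → K₁ ⇑ ⊆ K₂ ⇑
  ⇑-mono K₁ K₂ K₁⊆K₂ = map₂ λ (M⊆K₁ , rest) → (λ s∈M → K₁⊆K₂ (M⊆K₁ s∈M)) , rest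

  ⇑-∩ : ∀ (K₁ K₂ : Language) → (K₁ ∩ K₂) ⇑ ⊆ K₁ ⇑ ∩ K₂ ⇑
  ⇑-∩ K₁ K₂ s∈ = ⇑-mono (K₁ ∩ K₂) K₁ proj₁ s∈ , ⇑-mono (K₁ ∩ K₂) K₂ proj₂ s∈

  ⇑-∪ : ∀ (K₁ K₂ : Language) → K₁ ⇑ ∪ K₂ ⇑ ⊆ (K₁ ∪ K₂) ⇑
  ⇑-∪ K₁ K₂ = [ ⇑-mono K₁ (K₁ ∪ K₂) inj₁ , ⇑-mono K₂ (K₁ ∪ K₂) inj₂ ]

  -- Controllable languages, and distances from the empty string

  dHausdorff-self : ∀ (K : Language) → dHausdorff K K ≤ᵘ upper 0ℝ
  dHausdorff-self K {q} 0<q = sup , sup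
    where
    self : ∀ {r} → 0ℚ ℚ.< r → ∀ s → s ∈ K → r ∈ dPoint s K
    self 0<r s s∈K = inj₁
      (s , s∈K , upper-mono-≤ (dString s s) 0ℝ (dString-self s) (upper-fromℚ⁺ 0<r))

    sup : q ∈ supᵘ K (λ s → dPoint s K)
    -- `supᵘ` asks for a bound strictly below `q`, and an upper bound of the zero distance must be
    -- strictly positive.
    sup = let r , 0<r , r<q = ℚ.<-dense (upper-fromℚ⁻ {0ℚ} 0<q) in
      r , ℚ.<⇒≤ 0<r , r<q , self 0<r

  controllable⇒λ-controllable : ∀ (K : Language) → Controllable K → λ-Controllable K
  controllable⇒λ-controllable K K-ctrl = proj₁ K-ctrl , K , K-ctrl ,
    λ q∈ → dHausdorff-self K (upper-mono-≤ 0ℝ tolerance 0≤tolerance q∈)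

  controllable⊆⇑ : ∀ (K : Language) → Controllable K → K ⊆ K ⇑
  controllable⊆⇑ K K-ctrl s∈K = K , id , controllable⇒λ-controllable K K-ctrl , s∈K

  -- The first term alone contributes ½, since the padding symbol has distance 1 from `a`; the
  -- one-term sum evaluates to the constant ½ at every index.
  ½<dString-[] : ∀ a s {r} → r ∈ upper (dString (a ∷ s) []) → ½ ℚ.< r
  ½<dString-[] a s {r} r∈ = upper-fromℚ⁻ {½} first
    where
    first : r ∈ upper (∑< 1 (term (a ∷ s) []))
    first = upper-mono-≤ (∑< 1 (term (a ∷ s) [])) (dString (a ∷ s) [])
      (∑<-mono-≤ {1} {length (a ∷ s) ⊔ 0} (term (a ∷ s) []) (term (a ∷ s) []) (s≤s z≤n)
        (λ i _ → ≤-refl (term (a ∷ s) [] i)) (term-nonNeg (a ∷ s) [])) r∈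

-- The language u*

u* : Setting
u* = record
  { E           = ⊤
  ; E-finite    = 1 , ↔-sym 1↔⊤
  ; Ec          = ∅
  ; Euc         = U
  ; covering    = λ _ → inj₂ tt
  ; disjoint    = λ _ → proj₁
  ; G           = record { Q = ⊤ ; δ = λ _ _ → just tt ; q₀ = tt }
  ; d           = λ _ _ → 0ℝ
  ; d-metric    = record
    { isSemiMetric = record
      { isQuasiSemiMetric = record
        { isPreMetric = record
          { isProtoMetric = record
            { isPartialOrder  = ≤-isPartialOrder
            ; ≈-isEquivalence = isEquivalence
            ; cong            = λ _ _ → ≤-refl 0ℝ , ≤-refl 0ℝ
            ; nonNegative     = ≤-refl 0ℝ
            }
          ; ≈⇒0 = λ _ → ≤-refl 0ℝ , ≤-refl 0ℝ
          }
        ; 0⇒≈ = λ _ → refl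
        }
      ; sym = λ _ _ → ≤-refl 0ℝ , ≤-refl 0ℝ
      }
    ; triangle = λ _ _ _ → ≤-refl 0ℝ
    }
  ; d≤1         = λ _ _ → 0≤1
  ; tolerance   = 0ℝ
  ; 0≤tolerance = ≤-refl 0ℝ
  ; tolerance≤1 = 0≤1
  }
  where
  0≤1 : 0ℝ ≤ 1ℝ
  0≤1 n = ℚ.≤-trans (ℚ.≤ᵇ⇒≤ _) (≤-refl 1ℝ n)

module _ where
  open Setting u*

  L[G]-universal : ∀ s → s ∈ L[G]
  L[G]-universal []      = Maybe.just tt
  L[G]-universal (_ ∷ s) = L[G]-universal s

  cofinal-controllable : ∀ (K : Language) → (∀ s → s ∈ closure K) → Controllable K
  cofinal-controllable K cofinal = (λ {s} _ → L[G]-universal s) , λ {s} _ → cofinal s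

  ｛[]｝-not-λ-controllable : ∀ (M : Language) → M ⊆ ｛ [] ｝ → [] ∈ M → ¬ λ-Controllable M
  ｛[]｝-not-λ-controllable M M⊆[] []∈M (_ , K̃ , (_ , K̃-ctrl) , d≤0) =
    far (proj₁ d<½) (K̃-ctrl (([] , tt , refl , near (proj₂ d<½) , tt)
                            , L[G]-universal (tt ∷ [])))
    where
    d<½ : ½ ∈ dHausdorff K̃ M
    d<½ = d≤0 {½} (upper-fromℚ⁺ {0ℚ} {½} (ℚ.positive⁻¹ ½))

    1≮½ : ¬ (1ℚ ℚ.< ½)
    1≮½ (ℚ.*<* (ℤ.+<+ (s≤s ())))

    -- An empty `K̃` would be at distance 1, so `K̃` has a member, and `[]` is a prefix of it.
    near : ½ ∈ supᵘ M (λ s → dPoint s K̃) → [] ∈ closure K̃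
    near (r , _ , r<½ , r∈) =
      [ (λ (b , b∈K̃ , _) → b , b∈K̃)
      , (λ (_ , 1<r) → contradiction
          (ℚ.<-trans {1ℚ} {r} {½} (upper-fromℚ⁻ {1ℚ} {r} 1<r) r<½) 1≮½)
      ] (r∈ [] []∈M)

    ½<d : ∀ u b {r} → [] ≡ b → r ∈ upper (dString (tt ∷ u) b) → ½ ℚ.< r
    ½<d u _ refl = ½<dString-[] u* tt u

    -- A nonempty member of `K̃` can only be approximated in `M` by `[]`, which is at least ½ away.
    far : ½ ∈ supᵘ K̃ (λ s → dPoint s M) → ¬ (tt ∷ [] ∈ closure K̃)
    far (r , _ , r<½ , r∈) (u , uu∈K̃) =
      [ (λ (b , b∈M , r∈b) → ℚ.<-asym {r} {½} r<½ (½<d u b (M⊆[] b∈M) r∈b))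
      , (λ (M-empty , _) → M-empty [] []∈M)
      ] (r∈ (tt ∷ u) uu∈K̃)

  -- Serves both examples: `K` is the intersection in (3) and `｛ [] ｝` itself in (4).
  []∉⇑ : ∀ (K : Language) → K ⊆ ｛ [] ｝ → ¬ ([] ∈ K ⇑)
  []∉⇑ K K⊆[] (M , M⊆K , M-ctrl , []∈M) =
    ｛[]｝-not-λ-controllable M (λ s∈M → K⊆[] (M⊆K s∈M)) []∈M M-ctrl

  -- Languages for the strict inclusions

  EvenLength OddLength : Language
  EvenLength s = ∃[ n ] length s ≡ 2 ℕ.* n
  OddLength  s = ∃[ n ] length s ≡ suc (2 ℕ.* n)

  length-s++s : (s : List ⊤) → length (s ++ s) ≡ 2 ℕ.* length s
  length-s++s s = trans (List.length-++ s)
                    (cong (length s ℕ.+_) (sym (ℕ.+-identityʳ (length s))))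

  even-controllable : Controllable EvenLength
  even-controllable = cofinal-controllable _ λ s → s , length s , length-s++s s

  []∪odd-controllable : Controllable (｛ [] ｝ ∪ OddLength)
  -- Appending one event and then a copy of `s` gives odd length.
  []∪odd-controllable = cofinal-controllable _ λ s → tt ∷ s , inj₂ (length s ,
    trans (List.length-++ s) (trans (ℕ.+-suc _ _)
      (cong suc (trans (sym (List.length-++ s)) (length-s++s s)))))

  even∩[]∪odd⊆[] : EvenLength ∩ (｛ [] ｝ ∪ OddLength) ⊆ ｛ [] ｝
  even∩[]∪odd⊆[] (_ , inj₁ []≡s)                     = []≡s
  even∩[]∪odd⊆[] ((m , l≡2m) , inj₂ (n , l≡1+2n)) =
    contradiction (trans (sym l≡2m) l≡1+2n) (ℕ.even≢odd m n)

  all-controllable : Controllable (｛ [] ｝ ∪ ∁ ｛ [] ｝)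
  all-controllable = cofinal-controllable _ λ s → ⊆-closure (｛ [] ｝ ∪ ∁ ｛ [] ｝) (decide s)
    where
    decide : ∀ s → s ∈ ｛ [] ｝ ∪ ∁ ｛ [] ｝
    decide []      = inj₁ refl
    decide (_ ∷ _) = inj₂ λ ()

proposition4 : ((S : Setting) → let open Setting S in
    (∀ (K : Language) → K ⊆ L[G] → PrefixClosed K → PrefixClosed (K ⇑))
    × (∀ (K₁ K₂ : Language) → K₁ ⊆ L[G] → K₂ ⊆ L[G] → K₁ ⊆ K₂ → K₁ ⇑ ⊆ K₂ ⇑)
    × (∀ (K₁ K₂ : Language) → K₁ ⊆ L[G] → K₂ ⊆ L[G] → (K₁ ∩ K₂) ⇑ ⊆ K₁ ⇑ ∩ K₂ ⇑)
    × (∀ (K₁ K₂ : Language) → K₁ ⊆ L[G] → K₂ ⊆ L[G] → K₁ ⇑ ∪ K₂ ⇑ ⊆ (K₁ ∪ K₂) ⇑))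
    × (∃[ S ] let open Setting S in
    ∃[ K₁ ] ∃[ K₂ ] K₁ ⊆ L[G] × K₂ ⊆ L[G] × (K₁ ∩ K₂) ⇑ ⊂ K₁ ⇑ ∩ K₂ ⇑)
    × (∃[ S ] let open Setting S in
    ∃[ K₁ ] ∃[ K₂ ] K₁ ⊆ L[G] × K₂ ⊆ L[G] × K₁ ⇑ ∪ K₂ ⇑ ⊂ (K₁ ∪ K₂) ⇑)
proposition4 =
  (λ S → (λ K _ → ⇑-prefixClosed S K)
       , (λ K₁ K₂ _ _ → ⇑-mono S K₁ K₂)
       , (λ K₁ K₂ _ _ → ⇑-∩ S K₁ K₂)
       , (λ K₁ K₂ _ _ → ⇑-∪ S K₁ K₂))
  , (u* , EvenLength , ｛ [] ｝ ∪ OddLength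
    , (λ {s} _ → L[G]-universal s) , (λ {s} _ → L[G]-universal s)
    , ⇑-∩ u* _ _
    -- The string `[]` witnesses strictness: both languages are controllable and contain it.
    , λ ⊇ → []∉⇑ _ even∩[]∪odd⊆[]
        (⊇ ( controllable⊆⇑ u* _ even-controllable (0 , refl)
           , controllable⊆⇑ u* _ []∪odd-controllable (inj₁ refl))))
  , (u* , ｛ [] ｝ , ∁ ｛ [] ｝
    , (λ {s} _ → L[G]-universal s) , (λ {s} _ → L[G]-universal s)
    , ⇑-∪ u* _ _
    -- Again `[]` is the witness: the union is controllable, while the second language does not
    -- contain `[]` at all.
    , λ ⊇ → [ []∉⇑ _ id
            , (λ (_ , M⊆ , _ , []∈M) → M⊆ []∈M refl)
            ] (⊇ (controllable⊆⇑ u* _ all-controllable (inj₁ refl))))
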